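{- For every $n\ge 1$, the complete graph $K_n$ is a minimal element in the poset $\mathcal{S}_n$.
   Context: All graphs are finite and simple. The chromatic symmetric function of a graph $G$ with vertices $v_1,\dots,v_n$ is $X_G=\sum_{\kappa}x_{\kappa(v_1)}\cdots x_{\kappa(v_n)}$, summed over all proper colorings $\kappa:V(G)\to\{1,2,3,\dots\}$; it is a homogeneous symmetric function of degree $n$ over $\mathbb{Q}$. Let $s_\lambda$ be the Schur symmetric functions; $[s_\lambda]F$ denotes the coefficient of $s_\lambda$ in $F$ expanded in this basis, and $F$ is Schur-positive if $[s_\lambda]F\ge 0$ for all $\lambda$. For connected graphs $G,H$ on $n$ vertices (for which $[s_{(1^n)}]X_G$ and $[s_{(1^n)}]X_H$ are positive), set $$X_s(G,H)=X_G-\frac{[s_{(1^n)}]X_G}{[s_{(1^n)}]X_H}X_H.$$ $\mathcal{S}_n$ is the poset whose elements are the equivalence classes of connected graphs on $n$ vertices under $G\sim H\iff X_G=X_H$, ordered by $G\geq_s H$ if and only if $X_s(G,H)$ is Schur-positive. An element $x$ of a poset is minimal if $y\geq x$ for every $y$ comparable to $x$. -}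

module Defs where

open import Data.Nat.Base as ℕ using (ℕ; zero; suc; _≥_)
import Data.Nat.Properties as ℕ
open import Data.Nat.ListAction using (sum)
open import Data.Integer.Base using (+_)
open import Data.Rational.Base as ℚ using (ℚ; 0ℚ; NonZero; _÷_)
open import Data.Fin.Base using (Fin; finToFun)
open import Data.Fin.Properties using (_≟_; all?)
import Data.Fin.Base as Fin
import Data.Fin.Properties as Fin
open import Data.List.Base hiding (sum)
open import Data.List.Relation.Unary.All as All using (All)
open import Data.List.Relation.Unary.All.Properties using (replicate⁺)
open import Data.List.Relation.Unary.Linked using (Linked; []; [-]; _∷_; linked?)
open import Data.Maybe.Base as Maybe using (Maybe)
open import Data.Product.Base using (Σ; Σ-syntax; ∃; _×_; _,_; proj₁; proj₂; map₁)
open import Data.Sum.Base using (_⊎_)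
open import Level using (0ℓ; _⊔_) renaming (suc to lsuc)
open import Relation.Binary.Bundles.Raw using (RawRelation)
open import Relation.Binary.Construct.Closure.ReflexiveTransitive using (Star; ε; _◅_)
open import Relation.Binary.Core using (Rel)
open import Relation.Binary.Definitions using (Symmetric; Irreflexive; Decidable)
open import Relation.Binary.PropositionalEquality
  using (_≡_; _≢_; _≗_; refl; sym; trans; cong; cong₂; ≢-sym)
open import Relation.Nullary.Decidable using (Dec; yes; no; dec⇒maybe; ¬?; _×-dec_; _→-dec_)
import Relation.Unary as U

private
  variable
    n k m : ℕ

record Graph (n : ℕ) : Set₁ where
  field
    Adj    : Rel (Fin n) 0ℓ
    adj?   : Decidable Adj
    symm   : Symmetric Adj
    irrefl : Irreflexive _≡_ Adj

open Graph public

Connected : Graph n → Set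
Connected G = ∀ u v → Star (Adj G) u v

record ConnectedGraph (n : ℕ) : Set₁ where
  field
    graph     : Graph n
    connected : Connected graph

open ConnectedGraph public

complete : ∀ n → Graph n
complete n = record
  { Adj    = _≢_
  ; adj?   = λ u v → ¬? (u ≟ v)
  ; symm   = ≢-sym
  ; irrefl = λ u≡v u≢v → u≢v u≡v
  }

K : ∀ n → ConnectedGraph n
K n = record { graph = complete n ; connected = conn }
  where
  conn : Connected (complete n)
  conn u v with u ≟ v
  ... | yes refl = ε
  ... | no  u≢v  = u≢v ◅ ε

-- A formal power series over ℚ in x₁, x₂, … is given by its coefficients.
-- The list α₁ ∷ … ∷ αₖ ∷ [] stands for the monomial x₁^α₁ ⋯ xₖ^αₖ, so lists
-- differing only by trailing zeros stand for the same monomial; the series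
-- X and s below do not distinguish them.
Series : Set
Series = List ℕ → ℚ

infixl 6 _-_
infixr 7 _·_

_-_ : Series → Series → Series
(F - G) α = F α ℚ.- G α

_·_ : ℚ → Series → Series
(q · F) α = q ℚ.* F α

fromℕ : ℕ → ℚ
fromℕ c = + c ℚ./ 1

-- The number of maps Fin m → Fin k satisfying P; finToFun is a bijection
-- from Fin (k ^ m) onto these maps.
countMaps : {P : U.Pred (Fin m → Fin k) 0ℓ} → U.Decidable P → ℕ
countMaps {m} {k} P? = length (filter (λ i → P? (finToFun i)) (allFin (k ℕ.^ m)))

-- HasContent α f says that the product of the x_{f(i)} is the monomial α.
-- Only maps into the first (length α) variables can have this property.
HasContent : (α : List ℕ) → (Fin m → Fin (length α)) → Set
HasContent {m} α f = ∀ j → length (filter (λ i → f i ≟ j) (allFin m)) ≡ lookup α j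

hasContent? : (α : List ℕ) → U.Decidable (HasContent {m} α)
hasContent? α f = all? λ j → _ ℕ.≟ lookup α j

Proper : Graph n → (Fin n → Fin k) → Set
Proper G κ = ∀ u v → Adj G u v → κ u ≢ κ v

proper? : (G : Graph n) → U.Decidable (Proper {k = k} G)
proper? G κ = all? λ u → all? λ v → adj? G u v →-dec ¬? (κ u ≟ κ v)

X : Graph n → Series
X G α = fromℕ (countMaps λ κ → proper? G κ ×-dec hasContent? α κ)

IsPartition : ℕ → List ℕ → Set
IsPartition n xs = sum xs ≡ n × All (0 ℕ.<_) xs × Linked _≥_ xs

isPartition? : ∀ n → U.Decidable (IsPartition n)
isPartition? n xs =
  sum xs ℕ.≟ n ×-dec All.all? (0 ℕ.<?_) xs ×-dec linked? ℕ._≥?_ xs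

Partition : ℕ → Set
Partition n = ∃ (IsPartition n)

-- The lists of positive integers with sum n, each exactly once.
compositions : ℕ → List (List ℕ)
compositions zero    = [] ∷ []
compositions (suc n) = concatMap grow (compositions n)
  where
  grow : List ℕ → List (List ℕ)
  grow []       = (1 ∷ []) ∷ []
  grow (x ∷ xs) = (1 ∷ x ∷ xs) ∷ (suc x ∷ xs) ∷ []

partitions : ∀ n → List (Partition n)
partitions n =
  mapMaybe (λ xs → Maybe.map (xs ,_) (dec⇒maybe (isPartition? n xs))) (compositions n)

1^ : ∀ n → Partition n
1^ n = replicate n 1 , sum-1s n , replicate⁺ n ℕ.≤-refl , linked n
  where
  sum-1s : ∀ n → sum (replicate n 1) ≡ n
  sum-1s zero    = refl
  sum-1s (suc n) = cong suc (sum-1s n)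

  linked : ∀ n → Linked _≥_ (replicate n 1)
  linked zero          = []
  linked (suc zero)    = [-]
  linked (suc (suc n)) = ℕ.≤-refl ∷ linked (suc n)

-- The (row , column) positions of a Young diagram, in English notation.
cells : List ℕ → List (ℕ × ℕ)
cells []       = []
cells (r ∷ rs) = map (0 ,_) (upTo r) ++ map (map₁ suc) (cells rs)

module _ (rows : List ℕ) where

  Cell : Set
  Cell = Fin (length (cells rows))

  row col : Cell → ℕ
  row c = proj₁ (lookup (cells rows) c)
  col c = proj₂ (lookup (cells rows) c)

  SemiStandard : (Cell → Fin k) → Set
  SemiStandard T =
    (∀ c d → row c ≡ row d → col c ℕ.< col d → T c Fin.≤ T d) ×
    (∀ c d → col c ≡ col d → row c ℕ.< row d → T c Fin.< T d)

  semiStandard? : U.Decidable (SemiStandard {k = k})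
  semiStandard? T =
    (all? λ c → all? λ d → (row c ℕ.≟ row d) →-dec (col c ℕ.<? col d) →-dec (T c Fin.≤? T d)) ×-dec
    (all? λ c → all? λ d → (col c ℕ.≟ col d) →-dec (row c ℕ.<? row d) →-dec (T c Fin.<? T d))

-- The generating function of semistandard Young tableaux of the given shape.
s : Partition n → Series
s (rows , _) α = fromℕ (countMaps λ T → semiStandard? rows T ×-dec hasContent? α T)

∑ₛ : (Partition n → ℚ) → Series
∑ₛ {n} c α = foldr ℚ._+_ 0ℚ (map (λ p → c p ℚ.* s p α) (partitions n))

-- F = ∑_λ coeff(λ) s_λ. The Schur functions of degree n being a basis, every
-- homogeneous symmetric F of degree n has exactly one expansion, and coeff p
-- is then [s_p] F.
record SchurExpansion (n : ℕ) (F : Series) : Set where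
  field
    coeff   : Partition n → ℚ
    expands : F ≗ ∑ₛ coeff

open SchurExpansion public

SchurPositive : ℕ → Series → Set
SchurPositive n F = Σ[ E ∈ SchurExpansion n F ] (∀ p → 0ℚ ℚ.≤ coeff E p)

Xₛ : (G H : Graph n) (EG : SchurExpansion n (X G)) (EH : SchurExpansion n (X H)) →
     .{{_ : NonZero (coeff EH (1^ n))}} → Series
Xₛ {n} G H EG EH = X G - (coeff EG (1^ n) ÷ coeff EH (1^ n)) · X H

-- Division by [s_(1^n)] X_H needs evidence that it is nonzero. This always
-- holds, as the coefficient counts the acyclic orientations of H; the
-- evidence is carried by the relation, as are the expansions.
infix 4 _≈ₛ_ _≥ₛ_

_≥ₛ_ : Rel (ConnectedGraph n) 0ℓ
_≥ₛ_ {n} G H =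
  Σ[ EG ∈ SchurExpansion n (X (graph G)) ]
  Σ[ EH ∈ SchurExpansion n (X (graph H)) ]
  Σ[ nz ∈ NonZero (coeff EH (1^ n)) ]
  SchurPositive n (Xₛ (graph G) (graph H) EG EH {{nz}})

_≈ₛ_ : Rel (ConnectedGraph n) 0ℓ
G ≈ₛ H = X (graph G) ≗ X (graph H)

-- Equivalence classes are represented by their members, with _≈ₛ_ as the
-- equality; ≥ₛ-resp-≈ₛ shows that _≥ₛ_ is a relation between classes.
𝒮 : ℕ → RawRelation (lsuc 0ℓ) 0ℓ 0ℓ
𝒮 n = record { Carrier = ConnectedGraph n ; _≈_ = _≈ₛ_ ; _∼_ = _≥ₛ_ }

≥ₛ-resp-≈ₛ : {G G′ H H′ : ConnectedGraph n} → G ≈ₛ G′ → H ≈ₛ H′ → G ≥ₛ H → G′ ≥ₛ H′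
≥ₛ-resp-≈ₛ {n} G≈G′ H≈H′ (EG , EH , nz , E , 0≤E) =
  record { coeff = coeff EG ; expands = λ α → trans (sym (G≈G′ α)) (expands EG α) } ,
  record { coeff = coeff EH ; expands = λ α → trans (sym (H≈H′ α)) (expands EH α) } ,
  nz ,
  record
    { coeff   = coeff E
    ; expands = λ α → trans
        (sym (cong₂ (λ g h → g ℚ.- ratio ℚ.* h) (G≈G′ α) (H≈H′ α)))
        (expands E α)
    } ,
  0≤E
  where
  ratio : ℚ
  ratio = _÷_ (coeff EG (1^ n)) (coeff EH (1^ n)) {{nz}}

-- The relation _∼_ of the structure is read as "greater than or equal to".
Minimal : ∀ {a ℓ₁ ℓ₂} (S : RawRelation a ℓ₁ ℓ₂) → RawRelation.Carrier S → Set (a ⊔ ℓ₂)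
Minimal S x = ∀ y → (y ≥′ x ⊎ x ≥′ y) → y ≥′ x
  where open RawRelation S renaming (_∼_ to _≥′_)

{-# OPTIONS --safe #-}
module Submission where

-- Suppose K_n ≥ H, so that X_K − r X_H is Schur-positive, where r is the ratio
-- of the coefficients of s_(1^n).
-- If r < 0, then X_H − r⁻¹ X_K is −r⁻¹ times that series, so H ≥ K_n.
-- If r > 0, then H is complete and X_H = X_K: colouring two non-adjacent vertices
-- of H alike gives a monomial with positive coefficient in X_H and coefficient 0
-- in X_K, although a Schur-positive series has no negative coefficient.
-- The case r = 0 cannot occur, since [s_(1^n)] X_K ≠ 0. This uses that the
-- Kostka matrix is triangular with respect to n(λ) = ∑ (i − 1) λᵢ: an entry of a
-- semistandard tableau is at least its row index, so a tableau of shape λ and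
-- content μ gives n(λ) ≤ n(μ), with equality only if λ = μ.

open import Defs hiding (_-_)
open import Algebra.Properties.Semiring.Sum using ()
open import Data.Bool.Base using (true; false; if_then_else_)
open import Data.Fin.Base as Fin using (Fin; zero; suc; toℕ; fromℕ<; cast; finToFun; funToFin)
open import Data.Fin.Properties
  using (_≟_; all?; cast-is-id; finToFun-funToFin; toℕ-fromℕ<; toℕ-injective; toℕ<n; ¬∀⟶∃¬)
open import Data.List.Base hiding (sum)
open import Data.List.Membership.Propositional using (_∈_)
open import Data.List.Membership.Propositional.Properties
open import Data.List.Properties
open import Data.List.Relation.Unary.All as All using (All; []; _∷_)
open import Data.List.Relation.Unary.AllPairs using (AllPairs; _∷_)
open import Data.List.Relation.Unary.Any using (here; there; index)
open import Data.List.Relation.Unary.Any.Properties using (lookup-index)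
open import Data.List.Relation.Unary.Linked as Linked using (Linked; []; [-]; _∷_)
open import Data.List.Relation.Unary.Unique.Propositional.Properties using (allFin⁺; filter⁺)
open import Data.Nat.Base as ℕ using (ℕ; zero; suc; s≤s; z≤n; _≥_)
open import Data.Nat.Induction using (<-wellFounded)
open import Data.Nat.ListAction using (sum)
import Data.Nat.Properties as ℕ
open import Data.Product.Base using (∃; _×_; _,_; proj₁; proj₂; map₁)
open import Data.Sum.Base as Sum using (_⊎_; inj₁; inj₂)
open import Function.Base using (_∘_; id)
open import Function.Definitions using (Injective)
open import Induction.WellFounded using (Acc; acc)
open import Level using (0ℓ)
open import Relation.Binary.Definitions using (Tri; tri<; tri≈; tri>)
open import Relation.Binary.PropositionalEquality
open import Relation.Nullary
open import Relation.Unary using (Pred; Decidable; _≐_)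

private
  variable
    A B : Set
    m n k : ℕ

-- Fibres of maps between finite sets.

module _ where

  open import Data.Nat.Base using (_+_; _*_; _≤_; _<_)
  open import Data.Nat.Properties hiding (_≟_; suc-injective)
  open Algebra.Properties.Semiring.Sum +-*-semiring
    using (∑-distrib-+; sum-cong-≗; sum-replicate-zero) renaming (sum to ∑)

  length-filter-map : {P : Pred B 0ℓ} (P? : Decidable P) (f : A → B) (xs : List A) →
    length (filter P? (map f xs)) ≡ length (filter (P? ∘ f) xs)
  length-filter-map P? f []       = refl
  length-filter-map P? f (x ∷ xs) with does (P? (f x))
  ... | true  = cong suc (length-filter-map P? f xs)
  ... | false = length-filter-map P? f xs

  length-filter-lookup : {P : Pred A 0ℓ} (P? : Decidable P) (xs : List A) →
    length (filter (P? ∘ lookup xs) (allFin (length xs))) ≡ length (filter P? xs)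
  length-filter-lookup P? xs = trans
    (sym (length-filter-map P? (lookup xs) (allFin _)))
    (cong (length ∘ filter P?) (trans (map-tabulate id (lookup xs)) (tabulate-lookup xs)))

  -- The count in the definition of `HasContent`: `HasContent α f` unfolds to
  -- `fibre f j ≡ lookup α j` for all `j`.
  fibre : (Fin m → Fin k) → Fin k → ℕ
  fibre {m} f j = length (filter (λ i → f i ≟ j) (allFin m))

  δ : Fin k → Fin k → ℕ
  δ i j = if does (i ≟ j) then 1 else 0

  fibre-suc : (f : Fin (suc m) → Fin k) (j : Fin k) → fibre f j ≡ δ (f zero) j + fibre (f ∘ suc) j
  fibre-suc {m} f j with does (f zero ≟ j) | trans
    (cong (length ∘ filter (λ i → f i ≟ j)) (sym (map-tabulate id suc)))
    (length-filter-map (λ i → f i ≟ j) suc (allFin m))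
  ... | true  | tail≡ = cong suc tail≡
  ... | false | tail≡ = tail≡

  ∑-δ : (w : Fin k → ℕ) (i : Fin k) → ∑ (λ j → w j * δ i j) ≡ w i
  ∑-δ {suc k} w zero    = begin
    w zero * 1 + ∑ (λ j → w (suc j) * 0)
      ≡⟨ cong₂ _+_ (*-identityʳ (w zero)) (sum-cong-≗ (λ j → *-zeroʳ (w (suc j)))) ⟩
    w zero + ∑ {k} (λ _ → 0)
      ≡⟨ cong (w zero +_) (sum-replicate-zero k) ⟩
    w zero + 0
      ≡⟨ +-identityʳ (w zero) ⟩
    w zero ∎
    where open ≡-Reasoning
  ∑-δ {suc k} w (suc i) = cong₂ _+_ (*-zeroʳ (w zero)) (∑-δ (w ∘ suc) i)

  -- Induction on the domain: a new point raises one fibre by 1, and `∑-δ` picks out its weight.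
  -- Hence such a sum depends on `f` only through its content.
  ∑-by-fibres : (w : Fin k → ℕ) (f : Fin m → Fin k) → ∑ (w ∘ f) ≡ ∑ (λ j → w j * fibre f j)
  ∑-by-fibres {k} {zero}  w f = sym (trans (sum-cong-≗ (λ j → *-zeroʳ (w j))) (sum-replicate-zero k))
  ∑-by-fibres {k} {suc m} w f = begin
    w (f zero) + ∑ (w ∘ f ∘ suc)
      ≡⟨ cong₂ _+_ (∑-δ w (f zero)) (sym (∑-by-fibres w (f ∘ suc))) ⟨
    ∑ (λ j → w j * δ (f zero) j) + ∑ (λ j → w j * fibre (f ∘ suc) j)
      ≡⟨ ∑-distrib-+ (λ j → w j * δ (f zero) j) _ ⟨
    ∑ (λ j → w j * δ (f zero) j + w j * fibre (f ∘ suc) j)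
      ≡⟨ sum-cong-≗ (λ j → trans (cong (w j *_) (fibre-suc f j)) (*-distribˡ-+ (w j) (δ (f zero) j) _)) ⟨
    ∑ (λ j → w j * fibre f j) ∎
    where open ≡-Reasoning

  ∑-mono-≤ : {f g : Fin m → ℕ} → (∀ i → f i ≤ g i) → ∑ f ≤ ∑ g
  ∑-mono-≤ {zero}  f≤g = z≤n
  ∑-mono-≤ {suc m} f≤g = +-mono-≤ (f≤g zero) (∑-mono-≤ (f≤g ∘ suc))

  -- The tail of `f` sums to at most that of `g`, so equal totals force `g zero ≤ f zero`. With the
  -- heads equal, they cancel and the tails have equal sums again.
  ∑-≡⇒≗ : {f g : Fin m → ℕ} → (∀ i → f i ≤ g i) → ∑ f ≡ ∑ g → f ≗ g
  ∑-≡⇒≗ {suc m} {f} {g} f≤g ∑f≡∑g = λ where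
      zero    → head≡
      (suc i) → ∑-≡⇒≗ (f≤g ∘ suc) (+-cancelˡ-≡ (f zero) _ _ (trans ∑f≡∑g (cong (_+ _) (sym head≡)))) i
    where
    head≡ : f zero ≡ g zero
    head≡ = ≤-antisym (f≤g zero) (+-cancelʳ-≤ (∑ (f ∘ suc)) _ _ (≤-trans
      (+-monoʳ-≤ (g zero) (∑-mono-≤ (f≤g ∘ suc))) (≤-reflexive (sym ∑f≡∑g))))

  -- The list of preimages has no repetition, and injectivity identifies any two of its members.
  injective⇒fibre≤1 : {f : Fin m → Fin k} → Injective _≡_ _≡_ f → ∀ j → fibre f j ≤ 1
  injective⇒fibre≤1 {m} {f = f} inj j = at-most-one _ (filter⁺ f≟j (allFin⁺ m)) (proj₂ ∘ ∈-filter⁻ f≟j {xs = allFin m})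
    where
    f≟j = λ i → f i ≟ j
    at-most-one : ∀ xs → AllPairs _≢_ xs → (∀ {i} → i ∈ xs → f i ≡ j) → length xs ≤ 1
    at-most-one []          _             _ = z≤n
    at-most-one (_ ∷ [])    _             _ = ≤-refl
    at-most-one (_ ∷ _ ∷ _) ((x≢y ∷ _) ∷ _) h =
      contradiction (inj (trans (h (here refl)) (sym (h (there (here refl)))))) x≢y

  collision⇒2≤fibre : (f : Fin m → Fin k) {u v : Fin m} → u ≢ v → f u ≡ f v → 2 ≤ fibre f (f v)
  collision⇒2≤fibre {m} f {u} {v} u≢v fu≡fv =
    at-least-two (∈-filter⁺ f≟fv (∈-allFin u) fu≡fv) (∈-filter⁺ f≟fv (∈-allFin v) refl)
    where
    f≟fv = λ i → f i ≟ f v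
    at-least-two : ∀ {xs} → u ∈ xs → v ∈ xs → 2 ≤ length xs
    at-least-two {_ ∷ _ ∷ _} _           _           = s≤s (s≤s z≤n)
    at-least-two {_ ∷ []}    (here refl) (here refl) = contradiction refl u≢v

  -- Partitions as sequences, and the cells of Young diagrams.

  -- Entries past the end of the list count as 0.
  nth : List ℕ → ℕ → ℕ
  nth []       _       = 0
  nth (x ∷ _)  zero    = x
  nth (_ ∷ xs) (suc i) = nth xs i

  lookup≡nth : ∀ xs j → lookup xs j ≡ nth xs (toℕ j)
  lookup≡nth (_ ∷ _)  zero    = refl
  lookup≡nth (_ ∷ xs) (suc j) = lookup≡nth xs j

  nth>0⇒<length : ∀ xs i → 0 < nth xs i → i < length xs
  nth>0⇒<length (_ ∷ _)  zero    _ = s≤s z≤n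
  nth>0⇒<length (_ ∷ xs) (suc i) p = s≤s (nth>0⇒<length xs i p)

  nth-antitone : ∀ {xs} → Linked _≥_ xs → ∀ i → nth xs (suc i) ≤ nth xs i
  nth-antitone []         _       = z≤n
  nth-antitone [-]        _       = z≤n
  nth-antitone (x≥y ∷ _)  zero    = x≥y
  nth-antitone (_   ∷ xs) (suc i) = nth-antitone xs i

  -- Positive entries cannot be confused with the default value 0, so the sequence also determines
  -- the length.
  nth-injective : ∀ {xs ys} → All (0 <_) xs → All (0 <_) ys → nth xs ≗ nth ys → xs ≡ ys
  nth-injective []         []         _     = refl
  nth-injective []         (0<y ∷ _)  xs≗ys = contradiction (xs≗ys 0) (<⇒≢ 0<y)
  nth-injective (0<x ∷ _)  []         xs≗ys = contradiction (sym (xs≗ys 0)) (<⇒≢ 0<x)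
  nth-injective (_ ∷ 0<xs) (_ ∷ 0<ys) xs≗ys = cong₂ _∷_ (xs≗ys 0) (nth-injective 0<xs 0<ys (xs≗ys ∘ suc))

  ∈-cells⁻ : ∀ rs {c} → c ∈ cells rs → proj₂ c < nth rs (proj₁ c)
  ∈-cells⁻ (r ∷ rs) c∈ with ∈-++⁻ (map (0 ,_) (upTo r)) c∈
  ... | inj₁ c∈ˡ with _ , j∈ , refl ← ∈-map⁻ (0 ,_) c∈ˡ = ∈-upTo⁻ j∈
  ... | inj₂ c∈ʳ with _ , d∈ , refl ← ∈-map⁻ (map₁ suc) c∈ʳ = ∈-cells⁻ rs d∈

  ∈-cells⁺ : ∀ rs i {j} → j < nth rs i → (i , j) ∈ cells rs
  ∈-cells⁺ (r ∷ rs) zero    j<r = ∈-++⁺ˡ (∈-map⁺ (0 ,_) (∈-upTo⁺ j<r))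
  ∈-cells⁺ (r ∷ rs) (suc i) j<  = ∈-++⁺ʳ (map (0 ,_) (upTo r)) (∈-map⁺ (map₁ suc) (∈-cells⁺ rs i j<))

  row<length : ∀ rs c → row rs c < length rs
  row<length rs c = nth>0⇒<length rs (row rs c) (≤-<-trans z≤n (∈-cells⁻ rs (∈-lookup {xs = cells rs} c)))

  count-row : ∀ rs i → length (filter (λ c → row rs c ℕ.≟ i) (allFin (length (cells rs)))) ≡ nth rs i
  count-row rs i = trans (length-filter-lookup (λ c → proj₁ c ℕ.≟ i) (cells rs)) (count-cells rs i)
    where
    open ≡-Reasoning
    count-cells : ∀ rs i → length (filter (λ c → proj₁ c ℕ.≟ i) (cells rs)) ≡ nth rs i
    count-cells []       _ = refl
    count-cells (r ∷ rs) i = begin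
      length (filter P? (map (0 ,_) (upTo r) ++ map (map₁ suc) (cells rs)))
        ≡⟨ cong length (filter-++ P? (map (0 ,_) (upTo r)) _) ⟩
      length (filter P? (map (0 ,_) (upTo r)) ++ filter P? (map (map₁ suc) (cells rs)))
        ≡⟨ length-++ (filter P? (map (0 ,_) (upTo r))) ⟩
      length (filter P? (map (0 ,_) (upTo r))) + length (filter P? (map (map₁ suc) (cells rs)))
        ≡⟨ cong₂ _+_ (length-filter-map P? (0 ,_) (upTo r)) (length-filter-map P? (map₁ suc) (cells rs)) ⟩
      length (filter (P? ∘ (0 ,_)) (upTo r)) + length (filter (P? ∘ map₁ suc) (cells rs))
        ≡⟨ by-row i ⟩
      nth (r ∷ rs) i ∎
      where
      P? = λ (c : ℕ × ℕ) → proj₁ c ℕ.≟ i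
      -- Cells of row 0 come only from the first block, those of later rows only from the shifted
      -- block.
      by-row : ∀ i → length (filter (λ (_ : ℕ) → 0 ℕ.≟ i) (upTo r)) +
                     length (filter (λ (c : ℕ × ℕ) → suc (proj₁ c) ℕ.≟ i) (cells rs)) ≡ nth (r ∷ rs) i
      by-row zero    = begin
        length (filter _ (upTo r)) + length (filter _ (cells rs))
          ≡⟨ cong₂ (λ xs ys → length xs + length ys)
               (filter-all (λ _ → 0 ℕ.≟ 0) (All.universal (λ _ → refl) (upTo r)))
               (filter-none (λ c → suc (proj₁ c) ℕ.≟ 0) (All.universal (λ _ ()) (cells rs))) ⟩
        length (upTo r) + 0  ≡⟨ +-identityʳ _ ⟩
        length (upTo r)      ≡⟨ length-upTo r ⟩
        r                    ∎
      by-row (suc i) = cong₂ _+_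
        (cong length (filter-none (λ _ → 0 ℕ.≟ suc i) (All.universal (λ _ ()) (upTo r))))
        (trans
          (cong length (filter-≐ (λ c → suc (proj₁ c) ℕ.≟ suc i) (λ c → proj₁ c ℕ.≟ i)
            (ℕ.suc-injective , cong suc) (cells rs)))
          (count-cells rs i))

  -- Semistandard tableaux of given shape and content.

  superstandard : ∀ rs → Cell rs → Fin (length rs)
  superstandard rs c = fromℕ< (row<length rs c)

  toℕ-superstandard : ∀ rs c → toℕ (superstandard rs c) ≡ row rs c
  toℕ-superstandard rs c = toℕ-fromℕ< (row<length rs c)

  superstandard-semiStandard : ∀ rs → SemiStandard rs (superstandard rs)
  superstandard-semiStandard rs =
    (λ c d r≡ _ → ≤-reflexive (trans (toℕ-superstandard rs c) (trans r≡ (sym (toℕ-superstandard rs d))))) ,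
    (λ c d _ r< → subst₂ _<_ (sym (toℕ-superstandard rs c)) (sym (toℕ-superstandard rs d)) r<)

  -- Stated for any filling by row indices: it serves both the superstandard tableau and the
  -- extremal case in `weight≡⇒≡`.
  fibre-of-rows : ∀ rs (T : Cell rs → Fin k) → (∀ c → toℕ (T c) ≡ row rs c) → ∀ j → fibre T j ≡ nth rs (toℕ j)
  fibre-of-rows rs T T≡row j = trans
    (cong length (filter-≐ (λ c → T c ≟ j) (λ c → row rs c ℕ.≟ toℕ j)
      ( (λ {c} Tc≡j → trans (sym (T≡row c)) (cong toℕ Tc≡j))
      , (λ {c} r≡j → toℕ-injective (trans (T≡row c) r≡j)) ) (allFin _)))
    (count-row rs (toℕ j))

  superstandard-content : ∀ rs → HasContent rs (superstandard rs)
  superstandard-content rs j = trans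
    (fibre-of-rows rs (superstandard rs) (toℕ-superstandard rs) j) (sym (lookup≡nth rs j))

  -- Induction on the row. Since row lengths weakly decrease, there is a cell directly above, and
  -- strictness down the column raises the bound by one.
  row≤entry : ∀ {rs} {T : Cell rs → Fin k} → Linked _≥_ rs → SemiStandard rs T →
              ∀ c → row rs c ≤ toℕ (T c)
  row≤entry {rs = rs} {T} rs↓ (_ , cols<) c = go (row rs c) c refl
    where
    go : ∀ i c → row rs c ≡ i → i ≤ toℕ (T c)
    go zero    c _    = z≤n
    go (suc i) c r≡si = ≤-<-trans (go i d (cong proj₁ d≡)) (cols< d c (cong proj₂ d≡)
        (≤-reflexive (trans (cong (suc ∘ proj₁) d≡) (sym r≡si))))
      where
      above : (i , col rs c) ∈ cells rs
      above = ∈-cells⁺ rs i (<-≤-trans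
        (subst (λ r → col rs c < nth rs r) r≡si (∈-cells⁻ rs (∈-lookup {xs = cells rs} c)))
        (nth-antitone rs↓ i))
      d : Cell rs
      d = index above
      d≡ : lookup (cells rs) d ≡ (i , col rs c)
      d≡ = sym (lookup-index above)

  -- The statistic n(λ): with rows numbered from 0, each cell contributes its row index.
  weight : List ℕ → ℕ
  weight rs = ∑ (row rs)

  -- The sum of the entries depends only on the content, and the superstandard tableau of shape `μ`
  -- has content `μ` with row indices as entries.
  ∑-entries≡weight : ∀ μ (T : Fin m → Fin (length μ)) → HasContent μ T → ∑ (toℕ ∘ T) ≡ weight μ
  ∑-entries≡weight μ T T-content = begin
    ∑ (toℕ ∘ T)                                      ≡⟨ ∑-by-fibres toℕ T ⟩
    ∑ (λ j → toℕ j * fibre T j)                      ≡⟨ sum-cong-≗ (λ j → cong (toℕ j *_)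
                                                          (trans (T-content j) (sym (superstandard-content μ j)))) ⟩
    ∑ (λ j → toℕ j * fibre (superstandard μ) j)      ≡⟨ ∑-by-fibres toℕ (superstandard μ) ⟨
    ∑ (toℕ ∘ superstandard μ)                        ≡⟨ sum-cong-≗ (toℕ-superstandard μ) ⟩
    ∑ (row μ)                                        ∎
    where open ≡-Reasoning

  module _ (rs μ : List ℕ) (T : Cell rs → Fin (length μ))
           (rs↓ : Linked _≥_ rs) (T-ss : SemiStandard rs T) (T-content : HasContent μ T) where

    weight-mono : weight rs ≤ weight μ
    weight-mono = ≤-trans (∑-mono-≤ (row≤entry rs↓ T-ss)) (≤-reflexive (∑-entries≡weight μ T T-content))

    -- Equal weights leave no slack in `row≤entry`, so each entry is its row index; the content then
    -- lists the row lengths of the shape.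
    weight≡⇒≡ : All (0 <_) rs → All (0 <_) μ → weight rs ≡ weight μ → rs ≡ μ
    weight≡⇒≡ 0<rs 0<μ w≡ = nth-injective 0<rs 0<μ nth≗
      where
      row≡entry : ∀ c → row rs c ≡ toℕ (T c)
      row≡entry = ∑-≡⇒≗ (row≤entry rs↓ T-ss) (trans w≡ (sym (∑-entries≡weight μ T T-content)))

      nth≗ : nth rs ≗ nth μ
      nth≗ i with i <? length μ
      ... | yes i<ℓ = begin
        nth rs i                    ≡⟨ cong (nth rs) (toℕ-fromℕ< i<ℓ) ⟨
        nth rs (toℕ (fromℕ< i<ℓ))   ≡⟨ fibre-of-rows rs T (sym ∘ row≡entry) (fromℕ< i<ℓ) ⟨
        fibre T (fromℕ< i<ℓ)        ≡⟨ T-content (fromℕ< i<ℓ) ⟩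
        lookup μ (fromℕ< i<ℓ)       ≡⟨ lookup≡nth μ (fromℕ< i<ℓ) ⟩
        nth μ (toℕ (fromℕ< i<ℓ))    ≡⟨ cong (nth μ) (toℕ-fromℕ< i<ℓ) ⟩
        nth μ i                     ∎
        where open ≡-Reasoning
      -- Past the end of `μ` no entry can equal `i`, so row `i` of the shape is empty too.
      ... | no  i≮ℓ = begin
        nth rs i                    ≡⟨ count-row rs i ⟨
        _                           ≡⟨ cong length (filter-none (λ c → row rs c ℕ.≟ i)
                                         (All.universal row≢i (allFin _))) ⟩
        0                           ≡⟨ n≤0⇒n≡0 (≮⇒≥ (i≮ℓ ∘ nth>0⇒<length μ i)) ⟨
        nth μ i                     ∎
        where
        open ≡-Reasoning
        row≢i : ∀ c → row rs c ≢ i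
        row≢i c r≡i = i≮ℓ (subst (_< length μ) (trans (sym (row≡entry c)) r≡i) (toℕ<n (T c)))

-- Signs, quotients and finite sums in ℚ.

open import Data.Rational.Base hiding (_≥_; NonNegative)
open import Data.Rational.Properties as ℚ hiding (_≟_)
open import Data.Rational.Solver using (module +-*-Solver)

0≤p*q : ∀ {p q} → 0ℚ ≤ p → 0ℚ ≤ q → 0ℚ ≤ p * q
0≤p*q {p} {q} 0≤p 0≤q =
  nonNegative⁻¹ (p * q) {{nonNeg*nonNeg⇒nonNeg p {{nonNegative 0≤p}} q {{nonNegative 0≤q}}}}

0<p*q : ∀ {p q} → 0ℚ < p → 0ℚ < q → 0ℚ < p * q
0<p*q {p} {q} 0<p 0<q = positive⁻¹ (p * q) {{pos*pos⇒pos p {{positive 0<p}} q {{positive 0<q}}}}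

p≡0⇒p*q≡0 : ∀ p q → p ≡ 0ℚ → p * q ≡ 0ℚ
p≡0⇒p*q≡0 _ q refl = *-zeroˡ q

0<p² : ∀ {p} → p ≢ 0ℚ → 0ℚ < p * p
0<p² {p} p≢0 with <-cmp p 0ℚ
... | tri< p<0 _ _ = positive⁻¹ (p * p) {{neg*neg⇒pos p {{negative p<0}} p {{negative p<0}}}}
... | tri≈ _ p≡0 _ = contradiction p≡0 p≢0
... | tri> _ _ 0<p = 0<p*q 0<p 0<p

<⇒≱ : ∀ {p q} → p < q → ¬ (q ≤ p)
<⇒≱ p<q q≤p = <-irrefl refl (<-≤-trans p<q q≤p)

0≤fromℕ : ∀ c → 0ℚ ≤ fromℕ c
0≤fromℕ c = nonNegative⁻¹ (fromℕ c) {{normalize-nonNeg c 1}}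

0<fromℕ : ∀ {c} → 0 ℕ.< c → 0ℚ < fromℕ c
0<fromℕ {suc c} _ = positive⁻¹ (fromℕ (suc c)) {{normalize-pos (suc c) 1}}

÷-÷-inverse : ∀ p q .{{_ : NonZero p}} .{{_ : NonZero q}} → (q ÷ p) * (p ÷ q) ≡ 1ℚ
÷-÷-inverse p q = begin
  q * 1/ p * (p * 1/ q)     ≡⟨ solve 4 (λ p q p⁻¹ q⁻¹ →
                                 q :* p⁻¹ :* (p :* q⁻¹) := (p⁻¹ :* p) :* (q⁻¹ :* q)) refl p q (1/ p) (1/ q) ⟩
  (1/ p * p) * (1/ q * q)   ≡⟨ cong₂ _*_ (*-inverseˡ p) (*-inverseˡ q) ⟩
  1ℚ                        ∎
  where
  open ≡-Reasoning
  open +-*-Solver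

p÷q≡0⇒p≡0 : ∀ p q .{{_ : NonZero q}} → p ÷ q ≡ 0ℚ → p ≡ 0ℚ
p÷q≡0⇒p≡0 p q p÷q≡0 = begin
  p                ≡⟨ *-identityʳ p ⟨
  p * 1ℚ           ≡⟨ cong (p *_) (*-inverseˡ q) ⟨
  p * (1/ q * q)   ≡⟨ *-assoc p (1/ q) q ⟨
  (p ÷ q) * q      ≡⟨ cong (_* q) p÷q≡0 ⟩
  0ℚ * q           ≡⟨ *-zeroˡ q ⟩
  0ℚ               ∎
  where open ≡-Reasoning

-- If `p` were nonnegative, then `p * q` would be at most 0 and could not equal 1.
neg-cofactor-nonPos : ∀ p q → p * q ≡ 1ℚ → q < 0ℚ → 0ℚ ≤ - p
neg-cofactor-nonPos p q pq≡1 q<0 with ≤-total p 0ℚ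
... | inj₁ p≤0 = neg-antimono-≤ p≤0
... | inj₂ 0≤p = contradiction (subst (_≤ 0ℚ) pq≡1 (nonPositive⁻¹ (p * q)
  {{nonNeg*nonPos⇒nonPos p {{nonNegative 0≤p}} q {{nonPositive (<⇒≤ q<0)}}}})) (<⇒≱ (positive⁻¹ 1ℚ))

-- Meant for a monomial whose coefficient is `x` in X_K and `y` in X_H.
-ry≥0⇒r≯0 : ∀ x y r → x ≡ 0ℚ → 0ℚ < y → 0ℚ ≤ x - r * y → ¬ (0ℚ < r)
-ry≥0⇒r≯0 x y r refl 0<y 0≤-ry 0<r =
  <⇒≱ (neg-antimono-< (0<p*q 0<r 0<y)) (subst (0ℚ ≤_) (+-identityˡ (- (r * y))) 0≤-ry)

∑ℚ : (A → ℚ) → List A → ℚ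
∑ℚ t xs = foldr _+_ 0ℚ (map t xs)

module _ {t : A → ℚ} where

  ∑ℚ-nonNeg : ∀ {xs} → All (λ x → 0ℚ ≤ t x) xs → 0ℚ ≤ ∑ℚ t xs
  ∑ℚ-nonNeg []           = ≤-refl
  ∑ℚ-nonNeg (0≤t ∷ 0≤ts) = +-mono-≤ 0≤t (∑ℚ-nonNeg 0≤ts)

  ∑ℚ-zero : ∀ {xs} → All (λ x → t x ≡ 0ℚ) xs → ∑ℚ t xs ≡ 0ℚ
  ∑ℚ-zero []         = refl
  ∑ℚ-zero (t≡0 ∷ ts) = cong₂ _+_ t≡0 (∑ℚ-zero ts)

  ∑ℚ-pos : ∀ {xs y} → All (λ x → 0ℚ ≤ t x) xs → y ∈ xs → 0ℚ < t y → 0ℚ < ∑ℚ t xs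
  ∑ℚ-pos (_   ∷ 0≤ts) (here refl) 0<t = +-mono-<-≤ 0<t (∑ℚ-nonNeg 0≤ts)
  ∑ℚ-pos (0≤t ∷ 0≤ts) (there y∈)  0<t = +-mono-≤-< 0≤t (∑ℚ-pos 0≤ts y∈ 0<t)

-- Coefficients as counts of colourings and tableaux.

Colouring : Graph n → (α : List ℕ) → Pred (Fin n → Fin (length α)) 0ℓ
Colouring G α κ = Proper G κ × HasContent α κ

colouring? : (G : Graph n) (α : List ℕ) → Decidable (Colouring G α)
colouring? G α κ = proper? G κ ×-dec hasContent? α κ

Tableau : (rs α : List ℕ) → Pred (Cell rs → Fin (length α)) 0ℓ
Tableau rs α T = SemiStandard rs T × HasContent α T

tableau? : (rs α : List ℕ) → Decidable (Tableau rs α)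
tableau? rs α T = semiStandard? rs T ×-dec hasContent? α T

∑ₛ-zero : (c : Partition n → ℚ) → (∀ {p} → p ∈ partitions n → c p ≡ 0ℚ) → ∀ α → ∑ₛ c α ≡ 0ℚ
∑ₛ-zero c c≡0 α = ∑ℚ-zero (All.tabulate λ {p} p∈ → p≡0⇒p*q≡0 (c p) (s p α) (c≡0 p∈))

0≤s : ∀ (p : Partition n) α → 0ℚ ≤ s p α
0≤s (rs , _) α = 0≤fromℕ (countMaps (tableau? rs α))

∑ₛ-nonNeg : {c : Partition n → ℚ} → (∀ p → 0ℚ ≤ c p) → ∀ α → 0ℚ ≤ ∑ₛ c α
∑ₛ-nonNeg {n} 0≤c α = ∑ℚ-nonNeg (All.universal (λ p → 0≤p*q (0≤c p) (0≤s p α)) (partitions n))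

∑ₛ-scale : ∀ q (c : Partition n → ℚ) α → ∑ₛ (λ p → q * c p) α ≡ q * ∑ₛ c α
∑ₛ-scale {n} q c α = go (partitions n)
  where
  open ≡-Reasoning
  go : ∀ ps → ∑ℚ (λ p → q * c p * s p α) ps ≡ q * ∑ℚ (λ p → c p * s p α) ps
  go []       = sym (*-zeroʳ q)
  go (p ∷ ps) = begin
    q * c p * s p α + ∑ℚ (λ p → q * c p * s p α) ps          ≡⟨ cong₂ _+_ (*-assoc q (c p) (s p α)) (go ps) ⟩
    q * (c p * s p α) + q * ∑ℚ (λ p → c p * s p α) ps        ≡⟨ *-distribˡ-+ q _ _ ⟨
    q * (c p * s p α + ∑ℚ (λ p → c p * s p α) ps)            ∎

module _ {P : Pred (Fin m → Fin k) 0ℓ} (P? : Decidable P) where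

  countMaps≡0⊎∃ : countMaps P? ≡ 0 ⊎ ∃ P
  countMaps≡0⊎∃ with filter (λ i → P? (finToFun i)) (allFin (k ℕ.^ m)) in eq
  ... | []    = inj₁ refl
  ... | i ∷ _ = inj₂ (finToFun i , proj₂ (∈-filter⁻ (λ i → P? (finToFun i)) {xs = allFin (k ℕ.^ m)}
                                           (subst (i ∈_) (sym eq) (here refl))))

  -- A map agrees with its decoded code only pointwise, so `P` has to respect pointwise equality for
  -- the witness to be counted.
  0<countMaps : (∀ {f g} → f ≗ g → P f → P g) → ∃ P → 0 ℕ.< countMaps P?
  0<countMaps resp (f , Pf) = nonEmpty (∈-filter⁺ (λ i → P? (finToFun i)) (∈-allFin (funToFin f))
                                (resp (λ i → sym (finToFun-funToFin f i)) Pf))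
    where
    nonEmpty : ∀ {i : Fin (k ℕ.^ m)} {xs} → i ∈ xs → 0 ℕ.< length xs
    nonEmpty (here _)  = s≤s z≤n
    nonEmpty (there _) = s≤s z≤n

countMaps-cong : {P Q : Pred (Fin m → Fin k) 0ℓ} (P? : Decidable P) (Q? : Decidable Q) →
  P ≐ Q → countMaps P? ≡ countMaps Q?
countMaps-cong {m} {k} P? Q? (P⊆Q , Q⊆P) = cong length (filter-≐
  (λ i → P? (finToFun i)) (λ i → Q? (finToFun i))
  ((λ {i} → P⊆Q {finToFun i}) , (λ {i} → Q⊆P {finToFun i})) (allFin (k ℕ.^ m)))

hasContent-resp : ∀ α {f g : Fin m → Fin (length α)} → f ≗ g → HasContent α f → HasContent α g
hasContent-resp {m} α {f} {g} f≗g f-content j = trans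
  (cong length (filter-≐ (λ i → g i ≟ j) (λ i → f i ≟ j)
    ((λ {i} → trans (f≗g i)) , (λ {i} → trans (sym (f≗g i)))) (allFin m)))
  (f-content j)

proper-resp : (G : Graph n) {κ κ′ : Fin n → Fin k} → κ ≗ κ′ → Proper G κ → Proper G κ′
proper-resp G κ≗κ′ proper u v u~v κ′u≡κ′v =
  proper u v u~v (trans (κ≗κ′ u) (trans κ′u≡κ′v (sym (κ≗κ′ v))))

semiStandard-resp : ∀ rs {T T′ : Cell rs → Fin k} → T ≗ T′ → SemiStandard rs T → SemiStandard rs T′
semiStandard-resp rs T≗T′ (rows≤ , cols<) =
  (λ c d r≡ c< → subst₂ Fin._≤_ (T≗T′ c) (T≗T′ d) (rows≤ c d r≡ c<)) ,
  (λ c d c≡ r< → subst₂ Fin._<_ (T≗T′ c) (T≗T′ d) (cols< c d c≡ r<))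

content : (Fin m → Fin k) → List ℕ
content f = tabulate (fibre f)

0<X-content : (G : Graph n) (κ : Fin n → Fin k) → Proper G κ → 0ℚ < X G (content κ)
0<X-content G κ proper = go (content κ) (sym (length-tabulate (fibre κ))) (lookup-tabulate (fibre κ))
  where
  -- The length of `content κ` equals the number of colours only propositionally. Generalising over
  -- `α` lets that equation be matched with `refl`, so `κ` itself becomes a colouring with the right
  -- codomain.
  go : ∀ α (e : _ ≡ length α) → (∀ j → lookup α (cast e j) ≡ fibre κ j) → 0ℚ < X G α
  go α refl lookup≡fibre = 0<fromℕ (0<countMaps (colouring? G α)
    (λ κ≗κ′ (p , h) → proper-resp G κ≗κ′ p , hasContent-resp α κ≗κ′ h)
    (κ , proper , λ j → trans (sym (lookup≡fibre j)) (cong (lookup α) (cast-is-id refl j))))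

proper-complete⇒injective : {κ : Fin n → Fin k} → Proper (complete n) κ → Injective _≡_ _≡_ κ
proper-complete⇒injective proper {u} {v} κu≡κv with u ≟ v
... | yes u≡v = u≡v
... | no  u≢v = contradiction κu≡κv (proper u v u≢v)

-- A proper colouring of the complete graph is injective, so it uses no colour twice.
X-complete≡0 : ∀ n α j → 2 ℕ.≤ lookup α j → X (complete n) α ≡ 0ℚ
X-complete≡0 n α j 2≤αj = by-count (countMaps≡0⊎∃ (colouring? (complete n) α))
  where
  by-count : countMaps (colouring? (complete n) α) ≡ 0 ⊎ ∃ (Colouring (complete n) α) → X (complete n) α ≡ 0ℚ
  by-count (inj₁ count≡0)          = cong fromℕ count≡0
  by-count (inj₂ (κ , proper , h)) = contradiction 2≤αj (ℕ.<⇒≱ (s≤s (subst (ℕ._≤ 1) (h j)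
    (injective⇒fibre≤1 (proper-complete⇒injective proper) j))))

-- Triangularity of the Kostka matrix and the coefficient of s_(1^n) for the complete graph.

-- With `X-complete≡0`, this makes X_K vanish at every partition of n except 1^n.
¬1^⇒∃2≤ : ∀ n xs → sum xs ≡ n → All (0 ℕ.<_) xs → xs ≢ replicate n 1 → ∃ λ j → 2 ℕ.≤ lookup xs j
¬1^⇒∃2≤ zero    []                 _   _         ≢1^ = contradiction refl ≢1^
¬1^⇒∃2≤ _       (zero ∷ _)         _   (() ∷ _)  _
¬1^⇒∃2≤ (suc n) (1 ∷ xs)           sum≡ (_ ∷ 0<xs) ≢1^
  with j , 2≤ ← ¬1^⇒∃2≤ n xs (ℕ.suc-injective sum≡) 0<xs (≢1^ ∘ cong (1 ∷_)) = suc j , 2≤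
¬1^⇒∃2≤ _       (suc (suc _) ∷ xs) _   _         _   = zero , s≤s (s≤s z≤n)

-- Each proof component of a partition is unique.
partition-≡ : {p q : Partition n} → proj₁ p ≡ proj₁ q → p ≡ q
partition-≡ {p = xs , p₁ , p₂ , p₃} {_ , q₁ , q₂ , q₃} refl = cong (xs ,_)
  (cong₂ _,_ (ℕ.≡-irrelevant p₁ q₁)
    (cong₂ _,_ (All.irrelevant ℕ.≤-irrelevant p₂ q₂) (Linked.irrelevant ℕ.≤-irrelevant p₃ q₃)))

0<s-diagonal : (p : Partition n) → 0ℚ < s p (proj₁ p)
0<s-diagonal (μ , _) = 0<fromℕ (0<countMaps (tableau? μ μ)
  (λ T≗T′ (ss , h) → semiStandard-resp μ T≗T′ ss , hasContent-resp μ T≗T′ h)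
  (superstandard μ , superstandard-semiStandard μ , superstandard-content μ))

-- Any tableau of shape `q` and content `p` compares the two weights, and equality of weights forces
-- `q ≡ p`; without a tableau the coefficient is 0.
s-triangular : (q p : Partition n) →
  s q (proj₁ p) ≡ 0ℚ ⊎ weight (proj₁ q) ℕ.< weight (proj₁ p) ⊎ q ≡ p
s-triangular q@(rs , _ , 0<rs , rs↓) p@(μ , _ , 0<μ , _) = by-count (countMaps≡0⊎∃ (tableau? rs μ))
  where
  by-count : countMaps (tableau? rs μ) ≡ 0 ⊎ ∃ (Tableau rs μ) →
            s q μ ≡ 0ℚ ⊎ weight rs ℕ.< weight μ ⊎ q ≡ p
  by-count (inj₁ count≡0)      = inj₁ (cong fromℕ count≡0)
  by-count (inj₂ (T , ss , h)) = inj₂ (Sum.map₂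
    (λ w≡ → partition-≡ (weight≡⇒≡ rs μ T rs↓ ss h 0<rs 0<μ w≡))
    (ℕ.m≤n⇒m<n∨m≡n (weight-mono rs μ T rs↓ ss h)))

-- If this coefficient were 0, induction on weight would kill all the others: at the monomial `μ`
-- the left side is 0, shapes of smaller weight have coefficient 0 already, and the diagonal entry
-- is positive. Then X_K would be 0.
coeff-complete≢0 : (E : SchurExpansion n (X (complete n))) → coeff E (1^ n) ≢ 0ℚ
coeff-complete≢0 {n} E c₁≡0 = <⇒≢ 0<Xα (sym Xα≡0)
  where
  c = coeff E
  -- The monomial in which each of the n colours occurs once, realised by colouring each vertex with
  -- itself.
  α = content (id {A = Fin n})

  0<Xα : 0ℚ < X (complete n) α
  0<Xα = 0<X-content (complete n) id (λ _ _ u≢v → u≢v)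

  -- Membership is carried along because `∑ₛ` runs over `partitions n`: positivity of the sum at `μ`
  -- requires `p` to be one of its indices.
  vanish : ∀ p → Acc ℕ._<_ (weight (proj₁ p)) → p ∈ partitions n → c p ≡ 0ℚ
  vanish p@(μ , sum≡n , 0<μ , _) (acc rec) p∈ with ≡-dec ℕ._≟_ μ (replicate n 1) | c p ℚ.≟ 0ℚ
  ... | yes μ≡1^ | _        = trans (cong c (partition-≡ μ≡1^)) c₁≡0
  ... | no  _    | yes cp≡0 = cp≡0
  ... | no  μ≢1^ | no  cp≢0 = contradiction (sym ∑≡0) (<⇒≢ (∑ℚ-pos terms≥0 p∈ 0<term))
    where
    -- Multiplying the expansion by c p makes every term at μ nonnegative.
    term : Partition n → ℚ
    term q = c p * c q * s q μ

    0<term : 0ℚ < term p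
    0<term = 0<p*q (0<p² cp≢0) (0<s-diagonal p)

    terms≥0 : All (λ q → 0ℚ ≤ term q) (partitions n)
    terms≥0 = All.tabulate λ {q} q∈ → case q q∈ (s-triangular q p)
      where
      case : ∀ q → q ∈ partitions n → s q μ ≡ 0ℚ ⊎ weight (proj₁ q) ℕ.< weight μ ⊎ q ≡ p → 0ℚ ≤ term q
      case q _  (inj₁ s≡0)         = ≤-reflexive (sym (trans (cong (c p * c q *_) s≡0) (*-zeroʳ (c p * c q))))
      case q q∈ (inj₂ (inj₁ w<))   = ≤-reflexive (sym (trans
        (cong (λ z → c p * z * s q μ) (vanish q (rec w<) q∈))
        (trans (cong (_* s q μ) (*-zeroʳ (c p))) (*-zeroˡ (s q μ)))))
      case _ _  (inj₂ (inj₂ refl)) = <⇒≤ 0<term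

    Xμ≡0 : X (complete n) μ ≡ 0ℚ
    Xμ≡0 = let j , 2≤μj = ¬1^⇒∃2≤ n μ sum≡n 0<μ μ≢1^ in X-complete≡0 n μ j 2≤μj

    ∑≡0 : ∑ℚ term (partitions n) ≡ 0ℚ
    ∑≡0 = begin
      ∑ₛ (λ q → c p * c q) μ    ≡⟨ ∑ₛ-scale (c p) c μ ⟩
      c p * ∑ₛ c μ              ≡⟨ cong (c p *_) (expands E μ) ⟨
      c p * X (complete n) μ    ≡⟨ cong (c p *_) Xμ≡0 ⟩
      c p * 0ℚ                  ≡⟨ *-zeroʳ (c p) ⟩
      0ℚ                        ∎
      where open ≡-Reasoning

  Xα≡0 : X (complete n) α ≡ 0ℚ
  Xα≡0 = trans (expands E α) (∑ₛ-zero c (λ {p} → vanish p (<-wellFounded (weight (proj₁ p)))) α)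

-- Separating a graph from the complete graph.

X-cong : (G H : Graph n) → (∀ u v → Adj G u v → Adj H u v) → (∀ u v → Adj H u v → Adj G u v) → X G ≗ X H
X-cong G H G⇒H H⇒G α = cong fromℕ (countMaps-cong (colouring? G α) (colouring? H α)
  ( (λ (p , h) → (λ u v → p u v ∘ H⇒G u v) , h)
  , (λ (p , h) → (λ u v → p u v ∘ G⇒H u v) , h) ))

module _ (G : Graph n) {u v : Fin n} (u≢v : u ≢ v) (u≁v : ¬ Adj G u v) where

  identify : Fin n → Fin n
  identify w with w ≟ v
  ... | yes _ = u
  ... | no  _ = w

  identify-v : identify v ≡ u
  identify-v with v ≟ v
  ... | yes _   = refl
  ... | no  v≢v = contradiction refl v≢v

  identify-u : identify u ≡ u
  identify-u with u ≟ v
  ... | yes _ = refl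
  ... | no  _ = refl

  -- Only `u` and `v` share a colour. In the two mixed cases the endpoint other than `v` must be
  -- `u`, against `u≁v`.
  identify-proper : Proper G identify
  identify-proper a b a~b eq with a ≟ v | b ≟ v
  ... | yes refl | yes refl = irrefl G refl a~b
  ... | yes refl | no  _    = u≁v (subst (λ w → Adj G w v) (sym eq) (symm G a~b))
  ... | no  _    | yes refl = u≁v (subst (λ w → Adj G w v) eq a~b)
  ... | no  _    | no  _    = irrefl G eq a~b

  -- The monomial is the content of `identify`, where the colour `u` occurs at least twice.
  nonadjacent⇒separated : ∃ λ α → X (complete n) α ≡ 0ℚ × 0ℚ < X G α
  nonadjacent⇒separated = content identify ,
    X-complete≡0 n (content identify) (cast (sym (length-tabulate (fibre identify))) (identify v))
      (subst (2 ℕ.≤_) (sym (lookup-tabulate (fibre identify) (identify v)))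
        (collision⇒2≤fibre identify u≢v (trans identify-u (sym identify-v)))) ,
    0<X-content G identify identify-proper

-- Decidable adjacency on finitely many vertices turns a failure of completeness into an explicit
-- pair.
complete⊎nonadjacent : (G : Graph n) →
  (∀ u v → u ≢ v → Adj G u v) ⊎ (∃ λ u → ∃ λ v → u ≢ v × ¬ Adj G u v)
complete⊎nonadjacent {n} G with all? (λ u → all? λ v → ¬? (u ≟ v) →-dec adj? G u v)
... | yes adj = inj₁ adj
... | no ¬adj
  with u , ¬adjᵤ ← ¬∀⟶∃¬ n _ (λ u → all? λ v → ¬? (u ≟ v) →-dec adj? G u v) ¬adj
  with v , ¬adjᵤᵥ ← ¬∀⟶∃¬ n _ (λ v → ¬? (u ≟ v) →-dec adj? G u v) ¬adjᵤ
  = inj₂ (u , v , (λ u≡v → ¬adjᵤᵥ (contradiction u≡v)) , (λ u~v → ¬adjᵤᵥ (λ _ → u~v)))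

-- Reflexivity and reversal of the order.

-- The ratio is 1, so the difference is the zero series, expanded with zero coefficients.
≥ₛ-refl : (G : ConnectedGraph n) (E : SchurExpansion n (X (graph G))) → coeff E (1^ n) ≢ 0ℚ → G ≥ₛ G
≥ₛ-refl {n} G E c≢0 = E , E , nz , record { coeff = λ _ → 0ℚ ; expands = zero-expands } , (λ _ → ≤-refl)
  where
  nz : NonZero (coeff E (1^ n))
  nz = ≢-nonZero c≢0
  zero-expands : Xₛ (graph G) (graph G) E E {{nz}} ≗ ∑ₛ {n} (λ _ → 0ℚ)
  zero-expands α = begin
    X (graph G) α - (coeff E (1^ n) * 1/c) * X (graph G) α
      ≡⟨ cong (λ r → X (graph G) α - r * X (graph G) α) (*-inverseʳ (coeff E (1^ n)) {{nz}}) ⟩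
    X (graph G) α - 1ℚ * X (graph G) α  ≡⟨ cong (λ x → X (graph G) α - x) (*-identityˡ (X (graph G) α)) ⟩
    X (graph G) α - X (graph G) α       ≡⟨ +-inverseʳ (X (graph G) α) ⟩
    0ℚ                                  ≡⟨ ∑ₛ-zero {n} (λ _ → 0ℚ) (λ _ → refl) α ⟨
    ∑ₛ {n} (λ _ → 0ℚ) α                 ∎
    where
    open ≡-Reasoning
    1/c = 1/_ (coeff E (1^ n)) {{nz}}

≥ₛ-swap : {G H : ConnectedGraph n}
  (EG : SchurExpansion n (X (graph G))) (EH : SchurExpansion n (X (graph H)))
  .{{_ : NonZero (coeff EG (1^ n))}} .{{_ : NonZero (coeff EH (1^ n))}} →
  coeff EG (1^ n) ÷ coeff EH (1^ n) < 0ℚ →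
  SchurPositive n (Xₛ (graph G) (graph H) EG EH) → SchurPositive n (Xₛ (graph H) (graph G) EH EG)
≥ₛ-swap {n} {G} {H} EG EH r<0 (E , 0≤E) =
  record { coeff = λ p → - r′ * coeff E p ; expands = expands′ } , (λ p → 0≤p*q 0≤-r′ (0≤E p))
  where
  r r′ : ℚ
  r  = coeff EG (1^ n) ÷ coeff EH (1^ n)
  r′ = coeff EH (1^ n) ÷ coeff EG (1^ n)

  r′r≡1 : r′ * r ≡ 1ℚ
  r′r≡1 = ÷-÷-inverse (coeff EG (1^ n)) (coeff EH (1^ n))

  0≤-r′ : 0ℚ ≤ - r′
  0≤-r′ = neg-cofactor-nonPos r′ r r′r≡1 r<0

  expands′ : Xₛ (graph H) (graph G) EH EG ≗ ∑ₛ (λ p → - r′ * coeff E p)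
  expands′ α = begin
    -- Writing 1 as `r′ * r` exposes the common factor `- r′`, which is nonnegative because `r` is
    -- negative.
    y - r′ * x                    ≡⟨ cong (λ q → q - r′ * x) (*-identityˡ y) ⟨
    1ℚ * y - r′ * x               ≡⟨ cong (λ q → q * y - r′ * x) r′r≡1 ⟨
    r′ * r * y - r′ * x           ≡⟨ solve 4 (λ r r′ x y →
                                       r′ :* r :* y :- r′ :* x := (:- r′) :* (x :- r :* y)) refl r r′ x y ⟩
    - r′ * (x - r * y)            ≡⟨ cong (λ x → - r′ * x) (expands E α) ⟩
    - r′ * ∑ₛ (coeff E) α         ≡⟨ ∑ₛ-scale (- r′) (coeff E) α ⟨
    ∑ₛ (λ p → - r′ * coeff E p) α ∎
    where
    open ≡-Reasoning
    open +-*-Solver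
    x = X (graph G) α
    y = X (graph H) α

-- Minimality of the complete graph, by the sign of the ratio.

corollary4p5 : ∀ (n : ℕ) → n ≥ 1 → Minimal (𝒮 n) (K n)
corollary4p5 n _ H (inj₁ H≥K) = H≥K
corollary4p5 n _ H (inj₂ (EK , EH , nz , E , 0≤E)) = by-sign (<-cmp r 0ℚ)
  where
  r : ℚ
  r = _÷_ (coeff EK (1^ n)) (coeff EH (1^ n)) {{nz}}

  nzK : NonZero (coeff EK (1^ n))
  nzK = ≢-nonZero (coeff-complete≢0 EK)

  -- Schur functions have nonnegative monomial coefficients, so Schur-positivity passes to every
  -- monomial.
  0≤Xₛ : ∀ α → 0ℚ ≤ X (complete n) α - r * X (graph H) α
  0≤Xₛ α = subst (0ℚ ≤_) (sym (expands E α)) (∑ₛ-nonNeg 0≤E α)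

  separated⇒r≯0 : (∃ λ α → X (complete n) α ≡ 0ℚ × 0ℚ < X (graph H) α) → ¬ (0ℚ < r)
  separated⇒r≯0 (α , XK≡0 , 0<XH) = -ry≥0⇒r≯0 (X (complete n) α) (X (graph H) α) r XK≡0 0<XH (0≤Xₛ α)

  -- Here H has the same chromatic symmetric function as K_n, so reflexivity at K_n transports to H
  -- in the first place.
  adjacent⇒H≥K : (∀ u v → u ≢ v → Adj (graph H) u v) → H ≥ₛ K n
  adjacent⇒H≥K adj = ≥ₛ-resp-≈ₛ {G = K n} {H} {K n} {K n} K≈H (λ _ → refl) K≥K
    where
    K≈H : K n ≈ₛ H
    K≈H = X-cong (complete n) (graph H) adj (λ _ _ u~v u≡v → irrefl (graph H) u≡v u~v)
    K≥K : K n ≥ₛ K n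
    K≥K = ≥ₛ-refl (K n) EK (coeff-complete≢0 EK)

  r>0⇒H≥K : 0ℚ < r → H ≥ₛ K n
  r>0⇒H≥K 0<r = Sum.[ adjacent⇒H≥K , (λ (_ , _ , u≢v , u≁v) →
    contradiction 0<r (separated⇒r≯0 (nonadjacent⇒separated (graph H) u≢v u≁v))) ]′ (complete⊎nonadjacent (graph H))

  r<0⇒H≥K : r < 0ℚ → H ≥ₛ K n
  r<0⇒H≥K r<0 = EH , EK , nzK , ≥ₛ-swap {G = K n} {H} EK EH {{nzK}} {{nz}} r<0 (E , 0≤E)

  r≢0 : r ≢ 0ℚ
  r≢0 r≡0 = coeff-complete≢0 EK (p÷q≡0⇒p≡0 (coeff EK (1^ n)) (coeff EH (1^ n)) {{nz}} r≡0)

  by-sign : Tri (r < 0ℚ) (r ≡ 0ℚ) (r > 0ℚ) → H ≥ₛ K n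
  by-sign (tri< r<0 _ _) = r<0⇒H≥K r<0
  by-sign (tri≈ _ r≡0 _) = contradiction r≡0 r≢0
  by-sign (tri> _ _ 0<r) = r>0⇒H≥K 0<r
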